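{- For every integer $n\ge 2$, the origami flip graph ${\rm OFG}(M_{2,n})$ has exactly $8(n+1)3^{n-3}$ edges.
   Context: The $2\times n$ Miura-ori $M_{2,n}$ ($n\ge 1$) has faces $\alpha_{i,j}$ ($i\in\{1,2\}$ row, $j\in\{1,\dots,n\}$ column), interior vertices $x_1,\dots,x_{n-1}$, and creases $e_0$ and $e_{3k-1},e_{3k},e_{3k+1}$ for $k=1,\dots,n-1$. At $x_k$ the incident creases are left $e_{3k-3}$, top $e_{3k-1}$, right $e_{3k}$, bottom $e_{3k+1}$ (the two sector angles adjacent to the left crease are obtuse, the others acute). Face $\alpha_{1,j}$ is bordered by those of $e_{3j-4}$ (iff $j\ge2$), $e_{3j-3}$, $e_{3j-1}$ (iff $j\le n-1$); face $\alpha_{2,j}$ by those of $e_{3j-2}$ (iff $j\ge2$), $e_{3j-3}$, $e_{3j+1}$ (iff $j\le n-1$). An MV assignment is a map $\mu$ from the creases to $\{1,-1\}$ (mountain/valley); it is locally valid if for each $k$ exactly one of $\mu(e_{3k-1}),\mu(e_{3k}),\mu(e_{3k+1})$ differs from $\mu(e_{3k-3})$. The face flip $\mu_\alpha$ negates $\mu$ exactly on the creases bordering face $\alpha$; $\alpha$ is flippable under $\mu$ if $\mu$ and $\mu_\alpha$ are both locally valid. ${\rm OFG}(M_{2,n})$ has the locally valid MV assignments as vertices, with $\mu\sim\mu_\alpha$ for each flippable $\alpha$. -}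

module Defs where

open import Data.Bool.Base using (if_then_else_; true; false)
open import Data.Fin.Base using (Fin; zero; suc; toℕ; inject₁)
open import Data.Nat.Base using (ℕ; suc; _+_; _*_; _∸_; _≤_)
open import Data.Nat.Properties using (_≟_; _≤?_)
open import Data.Product using (Σ; ∃; ∃!; _×_; _,_)
open import Data.Sign.Base using (Sign; opposite)
open import Data.Sign.Properties using (opposite-selfInverse)
open import Data.Sum.Base using (_⊎_; inj₁; inj₂)
open import Function.Bundles using (Bijection)
open import Level using (0ℓ)
open import Relation.Binary.Bundles using (Setoid)
open import Relation.Binary.Core using (Rel)
open import Relation.Binary.Definitions using (Symmetric)
open import Relation.Binary.PropositionalEquality using (_≡_; _≢_; _≗_; refl; sym; trans; setoid)
open import Relation.Nullary.Decidable using (Dec; does; _×-dec_; _⊎-dec_)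

record Graph : Set₁ where
  field
    Vertices : Setoid 0ℓ 0ℓ
  open Setoid Vertices using () renaming (Carrier to Vertex) public
  field
    _∼_   : Rel Vertex 0ℓ
    ∼-sym : Symmetric _∼_

-- An edge is an unordered pair {u , v} with u ∼ v: ordered pairs are
-- identified with their swaps, and the adjacency witness is ignored.
Edges : Graph → Setoid 0ℓ 0ℓ
Edges G = record
  { Carrier = Σ Vertex λ u → Σ Vertex λ v → u ∼ v
  ; _≈_ = λ (u , v , _) (u′ , v′ , _) → (u ≈ u′ × v ≈ v′) ⊎ (u ≈ v′ × v ≈ u′)
  ; isEquivalence = record
    { refl  = inj₁ (V.refl , V.refl)
    ; sym   = λ { (inj₁ (p , q)) → inj₁ (V.sym p , V.sym q)
                ; (inj₂ (p , q)) → inj₂ (V.sym q , V.sym p) }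
    ; trans = λ { (inj₁ (p , q)) (inj₁ (r , s)) → inj₁ (V.trans p r , V.trans q s)
                ; (inj₁ (p , q)) (inj₂ (r , s)) → inj₂ (V.trans p r , V.trans q s)
                ; (inj₂ (p , q)) (inj₁ (r , s)) → inj₂ (V.trans p s , V.trans q r)
                ; (inj₂ (p , q)) (inj₂ (r , s)) → inj₁ (V.trans p s , V.trans q r) }
    }
  }
  where
  open Graph G
  module V = Setoid Vertices
  open V using (_≈_)

HasCardinality : Setoid 0ℓ 0ℓ → ℕ → Set
HasCardinality S N = Bijection (setoid (Fin N)) S

data Side : Set where
  top right bottom : Side

-- The interior vertex x_k (1 ≤ k ≤ n - 1) is the element of Fin (n ∸ 1)
-- with toℕ = k - 1; e s k is the crease on side s of that vertex.
data Crease (n : ℕ) : Set where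
  e₀ : Crease n
  e  : Side → Fin (n ∸ 1) → Crease n

-- The subscript i of the crease e_i: with k = suc (toℕ x), the top, right
-- and bottom creases at x are e_{3k-1}, e_{3k}, e_{3k+1}.
index : ∀ {n} → Crease n → ℕ
index e₀           = 0
index (e top x)    = 3 * suc (toℕ x) ∸ 1
index (e right x)  = 3 * suc (toℕ x)
index (e bottom x) = 3 * suc (toℕ x) + 1

-- The left crease e_{3k-3} at x_k is the right crease at x_{k-1}, or e_0.
left : ∀ {n} → Fin (n ∸ 1) → Crease n
left {suc (suc n)} zero    = e₀
left {suc (suc n)} (suc x) = e right (inject₁ x)

data Row : Set where
  row₁ row₂ : Row

-- The face α_{i,j} is (row i , the element of Fin n with toℕ = j - 1).
Face : ℕ → Set
Face n = Row × Fin n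

BordersAt : (n : ℕ) → Row → (j i : ℕ) → Set
BordersAt n row₁ j i =
  (2 ≤ j × i ≡ 3 * j ∸ 4) ⊎ i ≡ 3 * j ∸ 3 ⊎ (j ≤ n ∸ 1 × i ≡ 3 * j ∸ 1)
BordersAt n row₂ j i =
  (2 ≤ j × i ≡ 3 * j ∸ 2) ⊎ i ≡ 3 * j ∸ 3 ⊎ (j ≤ n ∸ 1 × i ≡ 3 * j + 1)

Borders : ∀ {n} → Crease n → Face n → Set
Borders {n} c (r , j) = BordersAt n r (suc (toℕ j)) (index c)

borders? : ∀ {n} (c : Crease n) (α : Face n) → Dec (Borders c α)
borders? {n} c (r , j) = dec r (suc (toℕ j)) (index c)
  where
  dec : ∀ r j i → Dec (BordersAt n r j i)
  dec row₁ j i =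
    (2 ≤? j ×-dec i ≟ 3 * j ∸ 4) ⊎-dec i ≟ 3 * j ∸ 3 ⊎-dec (j ≤? n ∸ 1 ×-dec i ≟ 3 * j ∸ 1)
  dec row₂ j i =
    (2 ≤? j ×-dec i ≟ 3 * j ∸ 2) ⊎-dec i ≟ 3 * j ∸ 3 ⊎-dec (j ≤? n ∸ 1 ×-dec i ≟ 3 * j + 1)

MVAssignment : ℕ → Set
MVAssignment n = Crease n → Sign

LocallyValid : ∀ {n} → MVAssignment n → Set
LocallyValid {n} μ = (x : Fin (n ∸ 1)) → ∃! _≡_ λ s → μ (e s x) ≢ μ (left x)

flip : ∀ {n} → MVAssignment n → Face n → MVAssignment n
flip μ α c = if does (borders? c α) then opposite (μ c) else μ c

Flippable : ∀ {n} → MVAssignment n → Face n → Set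
Flippable μ α = LocallyValid μ × LocallyValid (flip μ α)

LocallyValid-resp-≗ : ∀ {n} {μ ν : MVAssignment n} → μ ≗ ν → LocallyValid μ → LocallyValid ν
LocallyValid-resp-≗ μ≗ν valid x =
  let s , s-differs , s-unique = valid x in
  s ,
  (λ eq → s-differs (trans (μ≗ν (e s x)) (trans eq (sym (μ≗ν (left x)))))) ,
  (λ {t} t-differs → s-unique λ eq →
     t-differs (trans (sym (μ≗ν (e t x))) (trans eq (μ≗ν (left x)))))

flip-swap : ∀ {n} {μ ν : MVAssignment n} (α : Face n) → ν ≗ flip μ α → μ ≗ flip ν α
flip-swap α ν≗ c with does (borders? c α) | ν≗ c
... | true  | eq = sym (opposite-selfInverse (sym eq))
... | false | eq = sym eq

-- Assignments are compared pointwise, since functions are not extensional.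
OFG : ℕ → Graph
OFG n = record
  { Vertices = record
    { Carrier = Σ (MVAssignment n) LocallyValid
    ; _≈_ = λ (μ , _) (ν , _) → μ ≗ ν
    ; isEquivalence = record
      { refl  = λ _ → refl
      ; sym   = λ p c → sym (p c)
      ; trans = λ p q c → trans (p c) (q c)
      }
    }
  ; _∼_ = λ (μ , _) (ν , _) → ∃ λ α → Flippable μ α × ν ≗ flip μ α
  ; ∼-sym = λ { {μ , μ-valid} {ν , ν-valid} (α , _ , ν≗) →
      let μ≗ = flip-swap α ν≗ in
      α , (ν-valid , LocallyValid-resp-≗ μ≗ μ-valid) , μ≗ }
  }

{-# OPTIONS --safe #-}
-- A locally valid assignment is determined by the sign of one crease of the
-- middle line and, for each interior vertex, the letter (top, right or bottom)
-- of the unique crease that differs from the left one. Flipping a face of column j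
-- exchanges two letters at each interior vertex of the face, so it is possible
-- exactly when the letters there avoid one value each. Every flip of a face of
-- column j negates e_{3j-3}, so each edge has a unique orientation whose
-- source has that crease positive; hence edges correspond to triples of a row,
-- a column and an admissible word: 2 · 3^(n-2) words for each of the four corner
-- faces and 4 · 3^(n-3) for each of the 2 (n - 2) other faces.
module Submission where

open import Defs
open import Data.Bool.Base using (Bool; true; false; not; if_then_else_)
open import Data.Empty using (⊥)
open import Data.Fin.Base using (Fin; zero; suc; toℕ)
open import Data.Fin.Patterns using (0F; 1F; 2F)
open import Data.Fin.Properties using (+↔⊎; *↔×; 0↔⊥; 1↔⊤; 2↔Bool; suc-injective)
open import Data.Nat.Base using (ℕ; zero; suc; _+_; _*_; _^_; _∸_; _≤_; s≤s; s≤s⁻¹; z≤n)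
open import Data.Nat.Properties using (*-suc; *-monoʳ-≤; +-∸-assoc; ≤-refl; ≤-trans; m≤m+n; m∸n≤m; ∸-monoˡ-≤; ∸-monoʳ-≤)
open import Data.Nat.Tactic.RingSolver using (solve-∀)
open import Data.Product using (∃; ∃!; _×_; _,_; proj₁; proj₂; uncurry)
open import Data.Product.Function.NonDependent.Propositional using (_×-↔_)
open import Data.Product.Properties using (,-injectiveˡ; ,-injectiveʳ)
open import Data.Sign.Base using (Sign; opposite) renaming (+ to ⊕; - to ⊖)
open import Data.Sign.Properties using (s≢opposite[s]; opposite-involutive) renaming (_≟_ to _≟ˢ_)
open import Data.Sum.Base using (_⊎_; inj₁; inj₂)
open import Data.Sum.Function.Propositional using (_⊎-↔_)
open import Data.Unit.Base using (⊤; tt)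
open import Data.Vec.Base using (Vec; []; _∷_; uncons)
open import Data.Vec.Properties using (∷-injectiveˡ; ∷-injectiveʳ)
open import Function.Base using (_∘_)
open import Function.Bundles using (Bijection; _↔_; _⇔_; mk↔ₛ′; mk⇔)
open import Function.Construct.Composition using (bijection)
open import Function.Definitions using (Injective; Surjective)
open import Function.Properties.Inverse using (↔-trans; ↔⇒⤖)
open import Relation.Binary.Bundles using (Setoid)
open import Relation.Binary.Definitions using (DecidableEquality)
open import Relation.Binary.PropositionalEquality using (_≡_; _≢_; _≗_; refl; sym; trans; cong; cong₂; setoid; module ≡-Reasoning)
open import Relation.Nullary.Decidable using (yes; no; does; does-⇔; dec-true; dec-false; decidable-stable)
open import Relation.Nullary.Negation using (¬_; contradiction)

private
  variable
    m : ℕ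

-- The border relation as a recursion on columns.

-- Views the strip without its first column as a smaller Miura-ori: its `e₀` is the right crease at
-- the first vertex, so left creases go to left creases and subscripts grow by 3.
shift : Crease (suc m) → Crease (suc (suc m))
shift e₀      = e right zero
shift (e s x) = e s (suc x)

index-shift : (c : Crease (suc m)) → index (shift c) ≡ 3 + index c
index-shift e₀ = refl
index-shift (e top x)    = cong (_∸ 1) (*-suc 3 (suc (toℕ x)))
index-shift (e right x)  = *-suc 3 (suc (toℕ x))
index-shift (e bottom x) = cong (_+ 1) (*-suc 3 (suc (toℕ x)))

index-e≥2 : ∀ s (x : Fin m) → ∃ λ k → index {suc m} (e s x) ≡ 2 + k
index-e≥2 top    x = _ , cong (_∸ 1) (*-suc 3 (toℕ x))
index-e≥2 right  x = _ , *-suc 3 (toℕ x)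
index-e≥2 bottom x = _ , cong (_+ 1) (*-suc 3 (toℕ x))

index≢1 : (c : Crease (suc m)) → index c ≢ 1
index≢1 (e s x) eq with () ← trans (sym (proj₂ (index-e≥2 s x))) eq

2≤2+ : ∀ {t} → 2 ≤ 2 + t
2≤2+ = s≤s (s≤s z≤n)

-- Each defining equation moves by 3. The exception is the left crease `e_4` of the second face in
-- row 2: it would come from subscript 1, which no crease carries, whence `i ≢ 1`.
BordersAt-shift : ∀ n r t {i} → i ≢ 1 →
  BordersAt (suc (suc n)) r (2 + t) (3 + i) ⇔ BordersAt (suc n) r (suc t) i
BordersAt-shift n r t {i} i≢1 = mk⇔ (to r t) (from r t)
  where
  3*-∸ : ∀ t k → k ≤ 3 * suc t → 3 * (2 + t) ∸ k ≡ 3 + (3 * suc t ∸ k)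
  3*-∸ t k k≤ = trans (cong (_∸ k) (*-suc 3 (suc t))) (+-∸-assoc 3 k≤)

  3*-+1 : ∀ t → 3 * (2 + t) + 1 ≡ 3 + (3 * suc t + 1)
  3*-+1 t = cong (_+ 1) (*-suc 3 (suc t))

  ≤3* : ∀ {a k} t → k ≤ 3 * a → a ≤ t → k ≤ 3 * t
  ≤3* t k≤ a≤t = ≤-trans k≤ (*-monoʳ-≤ 3 a≤t)

  3*∸4 : ∀ t → 3 * (3 + t) ∸ 4 ≡ 3 + (3 * (2 + t) ∸ 4)
  3*∸4 t = 3*-∸ (suc t) 4 (≤3* (2 + t) (m≤m+n 4 2) (s≤s (s≤s z≤n)))

  3*∸ : ∀ t k → k ≤ 3 → 3 * (2 + t) ∸ k ≡ 3 + (3 * suc t ∸ k)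
  3*∸ t k k≤3 = 3*-∸ t k (≤3* (suc t) k≤3 (s≤s z≤n))

  down : ∀ {a b} → a ≡ 3 + b → 3 + i ≡ a → i ≡ b
  down q p = cong (_∸ 3) (trans p q)

  up : ∀ {a b} → a ≡ 3 + b → i ≡ b → 3 + i ≡ a
  up q p = trans (cong (3 +_) p) (sym q)

  to : ∀ r t → BordersAt (suc (suc n)) r (2 + t) (3 + i) → BordersAt (suc n) r (suc t) i
  to row₁ zero    (inj₁ (_ , ()))
  -- `3 * j ∸ 4` truncates at `j = 1`, so only later columns satisfy the shift identity.
  to row₁ (suc t) (inj₁ (_ , p))        = inj₁ (2≤2+ , down (3*∸4 t) p)
  to row₁ t       (inj₂ (inj₁ p))       = inj₂ (inj₁ (down (3*∸ t 3 ≤-refl) p))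
  to row₁ t       (inj₂ (inj₂ (l , p))) = inj₂ (inj₂ (s≤s⁻¹ l , down (3*∸ t 1 (s≤s z≤n)) p))
  to row₂ zero    (inj₁ (_ , p))        = contradiction (cong (_∸ 3) p) i≢1
  to row₂ (suc t) (inj₁ (_ , p))        = inj₁ (2≤2+ , down (3*∸ (suc t) 2 2≤2+) p)
  to row₂ t       (inj₂ (inj₁ p))       = inj₂ (inj₁ (down (3*∸ t 3 ≤-refl) p))
  to row₂ t       (inj₂ (inj₂ (l , p))) = inj₂ (inj₂ (s≤s⁻¹ l , down (3*-+1 t) p))

  from : ∀ r t → BordersAt (suc n) r (suc t) i → BordersAt (suc (suc n)) r (2 + t) (3 + i)
  from row₁ zero    (inj₁ (s≤s () , _))
  from row₁ (suc t) (inj₁ (_ , p))        = inj₁ (2≤2+ , up (3*∸4 t) p)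
  from row₁ t       (inj₂ (inj₁ p))       = inj₂ (inj₁ (up (3*∸ t 3 ≤-refl) p))
  from row₁ t       (inj₂ (inj₂ (l , p))) = inj₂ (inj₂ (s≤s l , up (3*∸ t 1 (s≤s z≤n)) p))
  from row₂ t       (inj₁ (_ , p))        = inj₁ (2≤2+ , up (3*∸ t 2 2≤2+) p)
  from row₂ t       (inj₂ (inj₁ p))       = inj₂ (inj₁ (up (3*∸ t 3 ≤-refl) p))
  from row₂ t       (inj₂ (inj₂ (l , p))) = inj₂ (inj₂ (s≤s l , up (3*-+1 t) p))

Borders-shift : ∀ r (j : Fin (suc m)) c → Borders (shift c) (r , suc j) ⇔ Borders c (r , j)
Borders-shift {m} r j c rewrite index-shift c = BordersAt-shift m r (toℕ j) (index≢1 c)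

_≟_ : DecidableEquality Side
top    ≟ top    = yes refl
top    ≟ right  = no λ ()
top    ≟ bottom = no λ ()
right  ≟ top    = no λ ()
right  ≟ right  = yes refl
right  ≟ bottom = no λ ()
bottom ≟ top    = no λ ()
bottom ≟ right  = no λ ()
bottom ≟ bottom = yes refl

own other : Row → Side
own row₁ = top
own row₂ = bottom
other row₁ = bottom
other row₂ = top

-- A face meets its preceding vertex in every crease but the left one and `other r`, and its
-- following vertex in the left crease and `own r`. In this form the border test computes without
-- subscript arithmetic.
touches : Row → Fin (suc m) → Crease (suc m) → Bool
touches r zero          e₀            = true
touches r zero          (e s zero)    = does (own r ≟ s)
touches r zero          (e s (suc x)) = false
touches r (suc j)       e₀            = false
touches r (suc zero)    (e s zero)    = not (does (other r ≟ s))
touches r (suc (suc j)) (e s zero)    = false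
touches r (suc j)       (e s (suc x)) = touches r j (e s x)

touches-shift : ∀ r (j : Fin (suc m)) c → touches r (suc j) (shift c) ≡ touches r j c
touches-shift row₁ zero    e₀      = refl
touches-shift row₂ zero    e₀      = refl
touches-shift r    (suc j) e₀      = refl
touches-shift r    zero    (e s x) = refl
touches-shift r    (suc j) (e s x) = refl

-- All border subscripts of column `j` are at least `3 * j ∸ 4`. The free bound `a` allows literals:
-- 2 excludes `e₀`, and 3 excludes the top and bottom creases of the first vertex.
≤-index : (α : Face (suc m)) (c : Crease (suc m)) → ∀ a → a ≤ suc (toℕ (proj₂ α)) →
  Borders c α → 3 * a ∸ 4 ≤ index c
≤-index {m} (r , j) c a a≤ b = ≤-trans (∸-monoˡ-≤ 4 (*-monoʳ-≤ 3 a≤)) (lower r b)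
  where
  J = suc (toℕ j)
  lower : ∀ {i} r → BordersAt (suc m) r J i → 3 * J ∸ 4 ≤ i
  lower row₁ (inj₁ (_ , refl))        = ≤-refl
  lower row₁ (inj₂ (inj₁ refl))       = ∸-monoʳ-≤ (3 * J) (m≤m+n 3 1)
  lower row₁ (inj₂ (inj₂ (_ , refl))) = ∸-monoʳ-≤ (3 * J) (m≤m+n 1 3)
  lower row₂ (inj₁ (_ , refl))        = ∸-monoʳ-≤ (3 * J) (m≤m+n 2 2)
  lower row₂ (inj₂ (inj₁ refl))       = ∸-monoʳ-≤ (3 * J) (m≤m+n 3 1)
  lower row₂ (inj₂ (inj₂ (_ , refl))) = ≤-trans (m∸n≤m (3 * J) 4) (m≤m+n (3 * J) 1)

-- Apart from `e₀` and the top and bottom creases of the first vertex, every crease is a shift, so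
-- beyond the first column only those three need a direct check.
borders?-touches : ∀ r (j : Fin (suc m)) c → does (borders? c (r , j)) ≡ touches r j c
borders?-shift : ∀ r (j : Fin (suc m)) c → does (borders? (shift c) (r , suc j)) ≡ touches r (suc j) (shift c)
borders?-shift r j c = begin
  does (borders? (shift c) (r , suc j)) ≡⟨ does-⇔ (Borders-shift r j c) (borders? (shift c) (r , suc j)) (borders? c (r , j)) ⟩
  does (borders? c (r , j))             ≡⟨ borders?-touches r j c ⟩
  touches r j c                         ≡⟨ touches-shift r j c ⟨
  touches r (suc j) (shift c)           ∎
  where open ≡-Reasoning

borders?-touches row₁ zero e₀ = refl
borders?-touches row₂ zero e₀ = refl
borders?-touches row₁ zero (e top zero) = refl
borders?-touches row₁ zero (e right zero) = refl
borders?-touches row₁ zero (e bottom zero) = refl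
borders?-touches row₂ zero (e top zero) = refl
borders?-touches row₂ zero (e right zero) = refl
borders?-touches row₂ zero (e bottom zero) = refl
borders?-touches {suc (suc m)} r zero c@(e s (suc x)) = dec-false (borders? c (r , zero)) (not-borders r)
  where
  not-borders : ∀ r → ¬ Borders {suc (suc (suc m))} (e s (suc x)) (r , zero)
  not-borders r b with index-e≥2 s x
  -- The subscript is now `5 + k`, whereas faces of the first column have borders among 0, 2 and 4.
  ... | k , eq rewrite index-shift (e {suc (suc m)} s x) | eq with r | b
  ... | row₁ | inj₁ (s≤s () , _)
  ... | row₁ | inj₂ (inj₁ ())
  ... | row₁ | inj₂ (inj₂ (_ , ()))
  ... | row₂ | inj₁ (s≤s () , _)
  ... | row₂ | inj₂ (inj₁ ())
  ... | row₂ | inj₂ (inj₂ (_ , ()))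
borders?-touches r (suc j) e₀ =
  dec-false (borders? e₀ (r , suc j)) λ b → contradiction (≤-index (r , suc j) e₀ 2 2≤2+ b) λ ()
borders?-touches r (suc j) (e right zero) = borders?-shift r j e₀
borders?-touches {suc m} row₁ (suc zero) (e top zero) =
  dec-true (borders? {suc (suc m)} (e top zero) (row₁ , suc zero)) (inj₁ (2≤2+ , refl))
borders?-touches {suc m} row₁ (suc zero) (e bottom zero) =
  dec-false (borders? {suc (suc m)} (e bottom zero) (row₁ , suc zero))
    λ { (inj₁ (_ , ())) ; (inj₂ (inj₁ ())) ; (inj₂ (inj₂ (_ , ()))) }
borders?-touches {suc m} row₂ (suc zero) (e top zero) =
  dec-false (borders? {suc (suc m)} (e top zero) (row₂ , suc zero))
    λ { (inj₁ (_ , ())) ; (inj₂ (inj₁ ())) ; (inj₂ (inj₂ (_ , ()))) }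
borders?-touches {suc m} row₂ (suc zero) (e bottom zero) =
  dec-true (borders? {suc (suc m)} (e bottom zero) (row₂ , suc zero)) (inj₁ (2≤2+ , refl))
borders?-touches r (suc (suc j)) (e top zero) =
  dec-false (borders? (e top zero) (r , suc (suc j)))
    λ b → contradiction (≤-index (r , suc (suc j)) (e top zero) 3 (s≤s 2≤2+) b) λ { (s≤s (s≤s ())) }
borders?-touches r (suc (suc j)) (e bottom zero) =
  dec-false (borders? (e bottom zero) (r , suc (suc j)))
    λ b → contradiction (≤-index (r , suc (suc j)) (e bottom zero) 3 (s≤s 2≤2+) b)
      λ { (s≤s (s≤s (s≤s (s≤s ())))) }
borders?-touches r (suc j) (e s (suc x)) = borders?-shift r j (e s x)

-- Flips in recursive form, and recovery of the face from its flip.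

toggle : MVAssignment (suc m) → Row → Fin (suc m) → MVAssignment (suc m)
toggle μ r j c = if touches r j c then opposite (μ c) else μ c

flip≗toggle : ∀ (μ : MVAssignment (suc m)) r j → flip μ (r , j) ≗ toggle μ r j
flip≗toggle μ r j c = cong (λ b → if b then opposite (μ c) else μ c) (borders?-touches r j c)

toggle-cong : ∀ {μ ν : MVAssignment (suc m)} r j → μ ≗ ν → toggle μ r j ≗ toggle ν r j
toggle-cong r j μ≗ν c = cong (λ a → if touches r j c then opposite a else a) (μ≗ν c)

toggle-shift : ∀ (μ : MVAssignment (suc (suc m))) r j → toggle μ r (suc j) ∘ shift ≗ toggle (μ ∘ shift) r j
toggle-shift μ r j c = cong (λ b → if b then opposite (μ (shift c)) else μ (shift c)) (touches-shift r j c)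

-- The crease e_{3j-3}, which borders the faces of column j in both rows.
middle : Fin (suc m) → Crease (suc m)
middle zero            = e₀
middle {suc m} (suc j) = shift (middle j)

touches-middle : ∀ r (j : Fin (suc m)) → touches r j (middle j) ≡ true
touches-middle r zero = refl
touches-middle {suc m} r (suc j) = trans (touches-shift r j (middle j)) (touches-middle r j)

toggle-middle : ∀ (μ : MVAssignment (suc m)) r j → toggle μ r j (middle j) ≡ opposite (μ (middle j))
toggle-middle μ r j rewrite touches-middle r j = refl

-- `e₀` singles out the first column, the right crease of the first vertex separates the second
-- column from later ones, and its top crease separates the rows. At least two columns are required:
-- in a single column both faces border only `e₀`.
touches-injective : ∀ r r′ (j j′ : Fin (suc (suc m))) →
  touches r j ≗ touches r′ j′ → (r , j) ≡ (r′ , j′)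
touches-injective r r′ zero (suc j′) eq with () ← eq e₀
touches-injective r r′ (suc j) zero eq with () ← eq e₀
touches-injective row₁ row₁ zero zero eq = refl
touches-injective row₂ row₂ zero zero eq = refl
touches-injective row₁ row₂ zero zero eq with () ← eq (e top zero)
touches-injective row₂ row₁ zero zero eq with () ← eq (e top zero)
touches-injective row₁ row₁ (suc zero) (suc zero) eq = refl
touches-injective row₂ row₂ (suc zero) (suc zero) eq = refl
touches-injective row₁ row₂ (suc zero) (suc zero) eq with () ← eq (e top zero)
touches-injective row₂ row₁ (suc zero) (suc zero) eq with () ← eq (e top zero)
touches-injective row₁ r′ (suc zero) (suc (suc j′)) eq with () ← eq (e right zero)
touches-injective row₂ r′ (suc zero) (suc (suc j′)) eq with () ← eq (e right zero)
touches-injective r row₁ (suc (suc j)) (suc zero) eq with () ← eq (e right zero)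
touches-injective r row₂ (suc (suc j)) (suc zero) eq with () ← eq (e right zero)
touches-injective {suc m} r r′ (suc j@(suc _)) (suc j′@(suc _)) eq
  with refl ← touches-injective r r′ j j′ (λ c →
    trans (sym (touches-shift r j c)) (trans (eq (shift c)) (touches-shift r′ j′ c))) = refl

toggle-injective : ∀ {μ ν : MVAssignment (suc (suc m))} r r′ j j′ →
  μ ≗ ν → toggle μ r j ≗ toggle ν r′ j′ → (r , j) ≡ (r′ , j′)
toggle-injective {μ = μ} {ν} r r′ j j′ μ≗ν eq = touches-injective r r′ j j′ λ c →
  cancel (touches r j c) (touches r′ j′ c) (μ c)
    (trans (eq c) (cong (λ a → if touches r′ j′ c then opposite a else a) (sym (μ≗ν c))))
  where
  cancel : ∀ a b σ → (if a then opposite σ else σ) ≡ (if b then opposite σ else σ) → a ≡ b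
  cancel true  true  σ p = refl
  cancel false false σ p = refl
  cancel true  false σ p = contradiction (sym p) (s≢opposite[s] σ)
  cancel false true  σ p = contradiction p (s≢opposite[s] σ)

-- Locally valid assignments as words.

-- The signs around a vertex whose left crease has sign `σ` and whose exceptional crease lies on
-- side `s`.
sideSign : Side → Sign → Side → Sign
sideSign s σ t = if does (s ≟ t) then opposite σ else σ

fromWord : Sign → Vec Side m → MVAssignment (suc m)
fromWord σ w       e₀            = σ
fromWord σ (s ∷ w) (e t zero)    = sideSign s σ t
fromWord σ (s ∷ w) (e t (suc x)) = fromWord (sideSign s σ right) w (e t x)

fromWord-shift : ∀ σ s (w : Vec Side m) → fromWord σ (s ∷ w) ∘ shift ≗ fromWord (sideSign s σ right) w
fromWord-shift σ s w e₀      = refl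
fromWord-shift σ s w (e t x) = refl

OneDiffers : Sign → (Side → Sign) → Set
OneDiffers σ f = ∃! _≡_ λ s → f s ≢ σ

-- The case split makes `left` compute: at the second vertex it is `shift e₀`, and at later vertices
-- it is again the shift of the left crease in the smaller strip.
valid-∷ : (μ : MVAssignment (suc (suc m))) →
  OneDiffers (μ e₀) (λ s → μ (e s zero)) → LocallyValid (μ ∘ shift) → LocallyValid μ
valid-∷ μ first rest zero          = first
valid-∷ μ first rest (suc zero)    = rest zero
valid-∷ μ first rest (suc (suc x)) = rest (suc x)

valid-tail : (μ : MVAssignment (suc (suc m))) → LocallyValid μ → LocallyValid (μ ∘ shift)
valid-tail μ valid zero    = valid (suc zero)
valid-tail μ valid (suc x) = valid (suc (suc x))

sideSign-oneDiffers : ∀ s σ → OneDiffers σ (sideSign s σ)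
sideSign-oneDiffers s σ = s , differs , unique
  where
  differs : sideSign s σ s ≢ σ
  differs rewrite dec-true (s ≟ s) refl = s≢opposite[s] σ ∘ sym
  unique : ∀ {t} → sideSign s σ t ≢ σ → s ≡ t
  unique {t} d with s ≟ t
  ... | yes eq = eq
  ... | no _   = contradiction refl d

fromWord-valid : ∀ σ (w : Vec Side m) → LocallyValid (fromWord σ w)
fromWord-valid σ (s ∷ w) = valid-∷ (fromWord σ (s ∷ w)) (sideSign-oneDiffers s σ)
  (LocallyValid-resp-≗ (λ c → sym (fromWord-shift σ s w c)) (fromWord-valid _ w))

≢⇒≡opposite : ∀ {σ τ} → σ ≢ τ → σ ≡ opposite τ
≢⇒≡opposite {⊕} {⊕} d = contradiction refl d
≢⇒≡opposite {⊕} {⊖} d = refl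
≢⇒≡opposite {⊖} {⊕} d = refl
≢⇒≡opposite {⊖} {⊖} d = contradiction refl d

oneDiffers-sideSign : ∀ {σ f} (d : OneDiffers σ f) → f ≗ sideSign (proj₁ d) σ
oneDiffers-sideSign {σ} {f} (s , differs , unique) t with s ≟ t
... | yes refl = ≢⇒≡opposite differs
... | no s≢t   = decidable-stable (f t ≟ˢ σ) (s≢t ∘ unique)

toWord : (μ : MVAssignment (suc m)) → LocallyValid μ → ∃ λ w → μ ≗ fromWord (μ e₀) w
toWord {zero} μ valid = [] , λ { e₀ → refl ; (e s ()) }
toWord {suc m} μ valid with s , first ← valid zero | w , rest ← toWord (μ ∘ shift) (valid-tail μ valid) =
  s ∷ w , eq
  where
  at-zero : (λ t → μ (e t zero)) ≗ sideSign s (μ e₀)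
  at-zero = oneDiffers-sideSign (s , first)
  eq : μ ≗ fromWord (μ e₀) (s ∷ w)
  eq e₀            = refl
  eq (e t zero)    = at-zero t
  eq (e t (suc x)) = trans (rest (e t x)) (cong (λ σ → fromWord σ w (e t x)) (at-zero right))

fromWord-injective : ∀ {σ τ} (w v : Vec Side m) → fromWord σ w ≗ fromWord τ v → w ≡ v
fromWord-injective [] [] eq = refl
fromWord-injective {σ = σ} (s ∷ w) (t ∷ v) eq with refl ← eq e₀ = cong₂ _∷_
  (sym (proj₂ (proj₂ (sideSign-oneDiffers t σ)) λ p →
    proj₁ (proj₂ (sideSign-oneDiffers s σ)) (trans (eq (e s zero)) p)))
  (fromWord-injective w v λ c →
    trans (sym (fromWord-shift _ s w c)) (trans (eq (shift c)) (fromWord-shift _ t v c)))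

-- The sign of e₀ for which the crease middle j has sign ⊕.
startSign : Fin (suc m) → Vec Side m → Sign
startSign zero    w       = ⊕
startSign (suc j) (s ∷ w) = sideSign s (startSign j w) right

-- Taken at `right`, this allows signs to be propagated backwards along the middle line, as
-- `startSign` does.
sideSign-involutive : ∀ s σ t → sideSign s (sideSign s σ t) t ≡ σ
sideSign-involutive s σ t with s ≟ t
... | yes _ = opposite-involutive σ
... | no _  = refl

fromWord-startSign : ∀ j (w : Vec Side m) → fromWord (startSign j w) w (middle j) ≡ ⊕
fromWord-startSign zero    w       = refl
fromWord-startSign (suc j) (s ∷ w) = trans (fromWord-shift _ s w (middle j))
  (trans (cong (λ σ → fromWord σ w (middle j)) (sideSign-involutive s _ right)) (fromWord-startSign j w))

startSign-unique : ∀ {σ} j (w : Vec Side m) → fromWord σ w (middle j) ≡ ⊕ → σ ≡ startSign j w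
startSign-unique zero    w       eq = eq
startSign-unique {σ = σ} (suc j) (s ∷ w) eq = trans (sym (sideSign-involutive s σ right))
  (cong (λ τ → sideSign s τ right)
    (startSign-unique j w (trans (sym (fromWord-shift σ s w (middle j))) eq)))

-- Codes for words with a flippable face.

-- The two letters allowed in row r for a flip, which exchanges them: after r at
-- the vertex following the face (whose left crease is negated), before r at the
-- vertex preceding it.

after before : Row → Bool → Side
after r true   = right
after r false  = other r
before r true  = right
before r false = own r

-- After m codes the words of length m that follow a flippable face; Before m
-- codes the words with a marked position, not the first, of a flippable face.
After : ℕ → Set
After zero    = ⊤
After (suc m) = Bool × Vec Side m

Before : ℕ → Set
Before zero    = ⊥
Before (suc m) = (Bool × After m) ⊎ (Side × Before m)

Flip : ℕ → Set
Flip m = After m ⊎ Before m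

afterWord : Row → After m → Vec Side m
afterWord {zero}  r tt      = []
afterWord {suc m} r (b , w) = after r b ∷ w

beforeWord : Row → Before m → Vec Side m
beforeWord {suc m} r (inj₁ (b , a)) = before r b ∷ afterWord r a
beforeWord {suc m} r (inj₂ (s , b)) = s ∷ beforeWord r b

word : Row → Flip m → Vec Side m
word r (inj₁ a) = afterWord r a
word r (inj₂ b) = beforeWord r b

-- Locates the vertex preceding the marked face; as an element of `Fin`, the column of the face is
-- its successor.
beforeColumn : Before m → Fin m
beforeColumn {suc m} (inj₁ _)       = zero
beforeColumn {suc m} (inj₂ (s , b)) = suc (beforeColumn b)

column : Flip m → Fin (suc m)
column (inj₁ a) = zero
column (inj₂ b) = suc (beforeColumn b)

after-injective : ∀ r {b b′} → after r b ≡ after r b′ → b ≡ b′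
after-injective r {true}  {true}  eq = refl
after-injective r {false} {false} eq = refl
after-injective row₁ {true}  {false} ()
after-injective row₂ {true}  {false} ()
after-injective row₁ {false} {true} ()
after-injective row₂ {false} {true} ()

before-injective : ∀ r {b b′} → before r b ≡ before r b′ → b ≡ b′
before-injective r {true}  {true}  eq = refl
before-injective r {false} {false} eq = refl
before-injective row₁ {true}  {false} ()
before-injective row₂ {true}  {false} ()
before-injective row₁ {false} {true} ()
before-injective row₂ {false} {true} ()

afterWord-injective : ∀ r (a a′ : After m) → afterWord r a ≡ afterWord r a′ → a ≡ a′
afterWord-injective {zero}  r tt tt eq = refl
afterWord-injective {suc m} r (b , w) (b′ , w′) eq =
  cong₂ _,_ (after-injective r (∷-injectiveˡ eq)) (∷-injectiveʳ eq)

beforeWord-injective : ∀ r (b b′ : Before m) →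
  beforeColumn b ≡ beforeColumn b′ → beforeWord r b ≡ beforeWord r b′ → b ≡ b′
beforeWord-injective {suc m} r (inj₁ (b , a)) (inj₁ (b′ , a′)) _ eq = cong inj₁
  (cong₂ _,_ (before-injective r (∷-injectiveˡ eq)) (afterWord-injective r a a′ (∷-injectiveʳ eq)))
beforeWord-injective {suc m} r (inj₂ (s , b)) (inj₂ (s′ , b′)) col eq = cong inj₂
  (cong₂ _,_ (∷-injectiveˡ eq) (beforeWord-injective r b b′ (suc-injective col) (∷-injectiveʳ eq)))

word-injective : ∀ r (f g : Flip m) → column f ≡ column g → word r f ≡ word r g → f ≡ g
word-injective r (inj₁ a) (inj₁ a′) col eq = cong inj₁ (afterWord-injective r a a′ eq)
word-injective r (inj₂ b) (inj₂ b′) col eq = cong inj₂ (beforeWord-injective r b b′ (suc-injective col) eq)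

-- The effect of a flip on words.

toggle-∷ : ∀ σ s (w : Vec Side m) r j →
  toggle (fromWord σ (s ∷ w)) r (suc j) ∘ shift ≗ toggle (fromWord (sideSign s σ right) w) r j
toggle-∷ σ s w r j c =
  trans (toggle-shift (fromWord σ (s ∷ w)) r j c) (toggle-cong r j (fromWord-shift σ s w) c)

-- The code of the same face after the flip: each adjacent vertex passes to its other allowed
-- letter.
swapAfter : After m → After m
swapAfter {zero}  tt      = tt
swapAfter {suc m} (b , w) = not b , w

swapBefore : Before m → Before m
swapBefore {suc m} (inj₁ (b , a)) = inj₁ (not b , swapAfter a)
swapBefore {suc m} (inj₂ (s , b)) = inj₂ (s , swapBefore b)

-- The flip negates the left and `own r` creases. If `right` was exceptional, `other r` now is the
-- only one to differ from the new left sign, and conversely.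
toggle-after : ∀ r b (w : Vec Side m) σ t →
  toggle (fromWord σ (after r b ∷ w)) r zero (e t zero) ≡ sideSign (after r (not b)) (opposite σ) t
toggle-after row₁ true  w σ top    = refl
toggle-after row₁ true  w σ right  = refl
toggle-after row₁ true  w σ bottom = sym (opposite-involutive σ)
toggle-after row₁ false w σ top    = refl
toggle-after row₁ false w σ right  = sym (opposite-involutive σ)
toggle-after row₁ false w σ bottom = refl
toggle-after row₂ true  w σ top    = sym (opposite-involutive σ)
toggle-after row₂ true  w σ right  = refl
toggle-after row₂ true  w σ bottom = refl
toggle-after row₂ false w σ top    = refl
toggle-after row₂ false w σ right  = sym (opposite-involutive σ)
toggle-after row₂ false w σ bottom = refl

-- Here the left crease is fixed while `own r` and `right` are both negated, so these two exchange
-- the role of exceptional crease.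
toggle-before : ∀ r b (w : Vec Side m) σ t →
  toggle (fromWord σ (before r b ∷ w)) r (suc zero) (e t zero) ≡ sideSign (before r (not b)) σ t
toggle-before row₁ true  w σ top    = refl
toggle-before row₁ true  w σ right  = opposite-involutive σ
toggle-before row₁ true  w σ bottom = refl
toggle-before row₁ false w σ top    = opposite-involutive σ
toggle-before row₁ false w σ right  = refl
toggle-before row₁ false w σ bottom = refl
toggle-before row₂ true  w σ top    = refl
toggle-before row₂ true  w σ right  = opposite-involutive σ
toggle-before row₂ true  w σ bottom = refl
toggle-before row₂ false w σ top    = refl
toggle-before row₂ false w σ right  = refl
toggle-before row₂ false w σ bottom = opposite-involutive σ

toggle-afterWord : ∀ r (a : After m) σ →
  toggle (fromWord σ (afterWord r a)) r zero ≗ fromWord (opposite σ) (afterWord r (swapAfter a))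
toggle-afterWord {zero}  r    a       σ e₀            = refl
toggle-afterWord {suc m} r    a       σ e₀            = refl
toggle-afterWord {suc m} r    (b , w) σ (e t zero)    = toggle-after r b w σ t
-- The right crease is not flipped, so the remaining word starts from the same sign. Splitting on
-- the row lets `own r ≟ right` evaluate.
toggle-afterWord {suc m} row₁ (b , w) σ (e t (suc x)) =
  cong (λ τ → fromWord τ w (e t x)) (toggle-after row₁ b w σ right)
toggle-afterWord {suc m} row₂ (b , w) σ (e t (suc x)) =
  cong (λ τ → fromWord τ w (e t x)) (toggle-after row₂ b w σ right)

toggle-beforeWord : ∀ r (b : Before m) σ →
  toggle (fromWord σ (beforeWord r b)) r (suc (beforeColumn b)) ≗ fromWord σ (beforeWord r (swapBefore b))
toggle-beforeWord {suc m} r (inj₁ (b , a)) σ e₀ = refl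
toggle-beforeWord {suc m} r (inj₁ (b , a)) σ (e t zero) = toggle-before r b (afterWord r a) σ t
toggle-beforeWord {suc m} r (inj₁ (b , a)) σ (e t (suc x)) = begin
  toggle (fromWord σ (before r b ∷ w)) r (suc zero) (e t (suc x))
    ≡⟨ toggle-∷ σ (before r b) w r zero (e t x) ⟩
  toggle (fromWord (sideSign (before r b) σ right) w) r zero (e t x)
    ≡⟨ toggle-afterWord r a _ (e t x) ⟩
  fromWord (opposite (sideSign (before r b) σ right)) w′ (e t x)
    ≡⟨ cong (λ τ → fromWord τ w′ (e t x)) (right-sign r) ⟩
  fromWord (sideSign (before r (not b)) σ right) w′ (e t x) ∎
  where
  open ≡-Reasoning
  w  = afterWord r a
  w′ = afterWord r (swapAfter a)
  -- The right crease here is the `e₀` of the remaining strip, so both sides of the vertex must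
  -- agree on its negated sign.
  right-sign : ∀ r → opposite (sideSign (before r b) σ right) ≡ sideSign (before r (not b)) σ right
  right-sign row₁ = toggle-before row₁ b w σ right
  right-sign row₂ = toggle-before row₂ b w σ right
toggle-beforeWord {suc m} r (inj₂ (s , b)) σ e₀ = refl
toggle-beforeWord {suc m} r (inj₂ (s , b)) σ (e t zero) = refl
toggle-beforeWord {suc m} r (inj₂ (s , b)) σ (e t (suc x)) =
  trans (toggle-∷ σ s (beforeWord r b) r (suc (beforeColumn b)) (e t x))
    (toggle-beforeWord r b _ (e t x))

toggle-valid : ∀ r (f : Flip m) σ → LocallyValid (toggle (fromWord σ (word r f)) r (column f))
toggle-valid r (inj₁ a) σ =
  LocallyValid-resp-≗ (λ c → sym (toggle-afterWord r a σ c)) (fromWord-valid _ _)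
toggle-valid r (inj₂ b) σ =
  LocallyValid-resp-≗ (λ c → sym (toggle-beforeWord r b σ c)) (fromWord-valid _ _)

-- Every valid flip comes from a code.

oneDiffers-unique : ∀ {σ f s t} → OneDiffers σ f → f s ≢ σ → f t ≢ σ → s ≡ t
oneDiffers-unique (_ , _ , unique) ds dt = trans (sym (unique ds)) (unique dt)

-- With the letter `own r`, all three other creases would differ from the negated left crease;
-- `right` and `other r` already contradict uniqueness.
valid-after : ∀ r σ (w : Vec Side m) → LocallyValid (toggle (fromWord σ w) r zero) →
  ∃ λ a → afterWord r a ≡ w
valid-after r    σ []           valid = tt , refl
valid-after r    σ (right  ∷ w) valid = (true , w) , refl
valid-after row₁ σ (bottom ∷ w) valid = (false , w) , refl
valid-after row₂ σ (top    ∷ w) valid = (false , w) , refl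
valid-after row₁ σ (top    ∷ w) valid
  with () ← oneDiffers-unique {s = right} {bottom} (valid zero) (s≢opposite[s] σ) (s≢opposite[s] σ)
valid-after row₂ σ (bottom ∷ w) valid
  with () ← oneDiffers-unique {s = right} {top} (valid zero) (s≢opposite[s] σ) (s≢opposite[s] σ)

valid-before : ∀ r σ j (w : Vec Side m) → LocallyValid (toggle (fromWord σ w) r (suc j)) →
  ∃ λ b → beforeColumn b ≡ j × beforeWord r b ≡ w
valid-before {suc m} r σ (suc j) (s ∷ w) valid
  with b , refl , refl ← valid-before r (sideSign s σ right) j w
    (LocallyValid-resp-≗ (toggle-∷ σ s w r (suc j))
      (valid-tail (toggle (fromWord σ (s ∷ w)) r (suc (suc j))) valid)) = inj₂ (s , b) , refl , refl
valid-before {suc m} r σ zero (s ∷ w) valid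
  with a , refl ← valid-after r (sideSign s σ right) w
    (LocallyValid-resp-≗ (toggle-∷ σ s w r zero)
      (valid-tail (toggle (fromWord σ (s ∷ w)) r (suc zero)) valid)) = first r s (valid zero)
  where
  first : ∀ r s → OneDiffers σ (λ t → toggle (fromWord σ (s ∷ afterWord r a)) r (suc zero) (e t zero)) →
    ∃ λ b → beforeColumn b ≡ zero × beforeWord r b ≡ s ∷ afterWord r a
  first r    right  _ = inj₁ (true , a) , refl , refl
  first row₁ top    _ = inj₁ (false , a) , refl , refl
  first row₂ bottom _ = inj₁ (false , a) , refl , refl
  -- The excluded letter is `other r`: negating `own r` and `right` makes all three creases differ
  -- from the unchanged left one.
  first row₁ bottom d
    with () ← oneDiffers-unique {s = right} {top} d (s≢opposite[s] σ ∘ sym) (s≢opposite[s] σ ∘ sym)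
  first row₂ top    d
    with () ← oneDiffers-unique {s = right} {bottom} d (s≢opposite[s] σ ∘ sym) (s≢opposite[s] σ ∘ sym)

toggle-valid⁻¹ : ∀ r σ j (w : Vec Side m) → LocallyValid (toggle (fromWord σ w) r j) →
  ∃ λ f → column f ≡ j × word r f ≡ w
toggle-valid⁻¹ r σ zero    w valid with a , eq ← valid-after r σ w valid = inj₁ a , refl , eq
toggle-valid⁻¹ r σ (suc j) w valid with b , refl , eq ← valid-before r σ j w valid = inj₂ b , refl , eq

-- The bijection between codes and edges.

flip-injective : ∀ {μ ν : MVAssignment (suc (suc m))} α β →
  μ ≗ ν → flip μ α ≗ flip ν β → α ≡ β
flip-injective {μ = μ} {ν} (r , j) (r′ , j′) μ≗ν eq = toggle-injective r r′ j j′ μ≗ν λ c →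
  trans (sym (flip≗toggle μ r j c)) (trans (eq c) (flip≗toggle ν r′ j′ c))

flip-cong : ∀ {μ ν : MVAssignment (suc m)} α → μ ≗ ν → flip μ α ≗ flip ν α
flip-cong α μ≗ν c = cong (λ a → if does (borders? c α) then opposite a else a) (μ≗ν c)

flip-middle : ∀ (μ : MVAssignment (suc m)) r j → flip μ (r , j) (middle j) ≡ opposite (μ (middle j))
flip-middle μ r j = trans (flip≗toggle μ r j (middle j)) (toggle-middle μ r j)

source : Row → Flip m → MVAssignment (suc m)
source r f = fromWord (startSign (column f) (word r f)) (word r f)

source-middle : ∀ r (f : Flip m) → source r f (middle (column f)) ≡ ⊕
source-middle r f = fromWord-startSign (column f) (word r f)

edge : Row × Flip m → Setoid.Carrier (Edges (OFG (suc m)))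
edge (r , f) = (μ , μ-valid) , (flip μ α , ν-valid) , α , (μ-valid , ν-valid) , λ _ → refl
  where
  α = r , column f
  μ = source r f
  μ-valid : LocallyValid μ
  μ-valid = fromWord-valid _ _
  ν-valid : LocallyValid (flip μ α)
  ν-valid = LocallyValid-resp-≗ (λ c → sym (flip≗toggle μ r (column f) c)) (toggle-valid r f _)

edge-injective : Injective _≡_ (Setoid._≈_ (Edges (OFG (suc (suc m))))) edge
edge-injective {x = r , f} {r′ , f′} (inj₁ (μ≗ , ν≗))
  -- With equal orientations, the two endpoints determine the face, and the source then determines
  -- the word.
  with eq ← flip-injective (r , column f) (r′ , column f′) μ≗ ν≗
  with refl ← ,-injectiveˡ eq =
  cong (r ,_) (word-injective r f f′ (,-injectiveʳ eq) (fromWord-injective (word r f) (word r f′) μ≗))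
-- The middle crease of the face is ⊕ at the source and ⊖ at the target, so no
-- coded edge is the reversal of another.
edge-injective {x = r , f} {r′ , f′} (inj₂ (μ≗ , ν≗)) = contradiction
  (begin
    ⊕
      ≡⟨ source-middle r f ⟨
    source r f (middle (column f))
      ≡⟨ μ≗ (middle (column f)) ⟩
    flip (source r′ f′) (r′ , column f′) (middle (column f))
      ≡⟨ cong (flip (source r′ f′) (r′ , column f′) ∘ middle) (,-injectiveʳ same) ⟩
    flip (source r′ f′) (r′ , column f′) (middle (column f′))
      ≡⟨ flip-middle (source r′ f′) r′ (column f′) ⟩
    opposite (source r′ f′ (middle (column f′)))
      ≡⟨ cong opposite (source-middle r′ f′) ⟩
    ⊖ ∎)
  λ ()
  where
  open ≡-Reasoning
  same : (r , column f) ≡ (r′ , column f′)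
  -- Flips are involutions, so flipping either face in `source r′ f′` yields `source r f`.
  same = flip-injective {ν = source r′ f′} (r , column f) (r′ , column f′) (λ _ → refl) λ c →
    trans (sym (flip-swap (r , column f) (λ c → sym (ν≗ c)) c)) (μ≗ c)

-- Validity of `ν` makes the word of `μ` admissible at the face, and the positive middle crease
-- forces the sign of `e₀` to be `startSign`.
edge-covers : ∀ r j {μ ν : MVAssignment (suc m)} → LocallyValid μ → LocallyValid ν →
  ν ≗ flip μ (r , j) → μ (middle j) ≡ ⊕ →
  ∃ λ f → source r f ≗ μ × flip (source r f) (r , column f) ≗ ν
edge-covers r j {μ} {ν} μ-valid ν-valid ν≗ positive
  with w , μ≗ ← toWord μ μ-valid
  with f , refl , refl ← toggle-valid⁻¹ r (μ e₀) j w
    (LocallyValid-resp-≗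
      (λ c → trans (ν≗ c) (trans (flip≗toggle μ r j c) (toggle-cong r j μ≗ c))) ν-valid) =
  f , source≗ , λ c → trans (flip-cong (r , j) source≗ c) (sym (ν≗ c))
  where
  source≗ : source r f ≗ μ
  source≗ c = trans
    (cong (λ σ → fromWord σ w c) (sym (startSign-unique j w (trans (sym (μ≗ (middle j))) positive))))
    (sym (μ≗ c))

edge-surjective : Surjective _≡_ (Setoid._≈_ (Edges (OFG (suc m)))) edge
edge-surjective {m} ((μ , μ-valid) , (ν , ν-valid) , (r , j) , _ , ν≗) with μ (middle j) in eq
... | ⊕ with f , p , q ← edge-covers r j μ-valid ν-valid ν≗ eq = (r , f) , λ { refl → inj₁ (p , q) }
-- The flip negates the middle crease, so it is `⊕` at `ν` and the code describes the edge traversed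
-- backwards.
... | ⊖ with f , p , q ← edge-covers r j ν-valid μ-valid (flip-swap (r , j) ν≗)
             (trans (ν≗ (middle j)) (trans (flip-middle μ r j) (cong opposite eq)))
        = (r , f) , λ { refl → inj₂ (p , q) }

edgeBijection : Bijection (setoid (Row × Flip (suc m))) (Edges (OFG (suc (suc m))))
edgeBijection {m} = record
  { to        = edge
  ; cong      = λ { {x} refl → Setoid.refl (Edges (OFG (suc (suc m)))) {edge x} }
  ; bijective = edge-injective , edge-surjective
  }

-- Counting the codes.

#After #Before : ℕ → ℕ
#After zero     = 1
#After (suc m)  = 2 * 3 ^ m
#Before zero    = 0
#Before (suc m) = 2 * #After m + 3 * #Before m

Fin↔Side : Fin 3 ↔ Side
Fin↔Side = mk↔ₛ′ (λ { 0F → top ; 1F → right ; 2F → bottom }) (λ { top → 0F ; right → 1F ; bottom → 2F })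
  (λ { top → refl ; right → refl ; bottom → refl }) (λ { 0F → refl ; 1F → refl ; 2F → refl })

Fin↔Row : Fin 2 ↔ Row
Fin↔Row = mk↔ₛ′ (λ { 0F → row₁ ; 1F → row₂ }) (λ { row₁ → 0F ; row₂ → 1F })
  (λ { row₁ → refl ; row₂ → refl }) (λ { 0F → refl ; 1F → refl })

Fin↔× : ∀ {a b} {A B : Set} → Fin a ↔ A → Fin b ↔ B → Fin (a * b) ↔ (A × B)
Fin↔× f g = ↔-trans *↔× (f ×-↔ g)

Fin↔⊎ : ∀ {a b} {A B : Set} → Fin a ↔ A → Fin b ↔ B → Fin (a + b) ↔ (A ⊎ B)
Fin↔⊎ f g = ↔-trans +↔⊎ (f ⊎-↔ g)

⊤↔[] : ⊤ ↔ Vec Side 0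
⊤↔[] = mk↔ₛ′ (λ _ → []) (λ _ → tt) (λ { [] → refl }) (λ _ → refl)

×↔∷ : (Side × Vec Side m) ↔ Vec Side (suc m)
×↔∷ = mk↔ₛ′ (uncurry _∷_) uncons (λ { (s ∷ w) → refl }) (λ _ → refl)

Fin↔Word : ∀ m → Fin (3 ^ m) ↔ Vec Side m
Fin↔Word zero    = ↔-trans 1↔⊤ ⊤↔[]
Fin↔Word (suc m) = ↔-trans (Fin↔× Fin↔Side (Fin↔Word m)) ×↔∷

Fin↔After : ∀ m → Fin (#After m) ↔ After m
Fin↔After zero    = 1↔⊤
Fin↔After (suc m) = Fin↔× 2↔Bool (Fin↔Word m)

Fin↔Before : ∀ m → Fin (#Before m) ↔ Before m
Fin↔Before zero    = 0↔⊥
Fin↔Before (suc m) = Fin↔⊎ (Fin↔× 2↔Bool (Fin↔After m)) (Fin↔× Fin↔Side (Fin↔Before m))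

-- Among `k + 2` columns, the last contributes `2 * 3 ^ k` and each of the `k` inner ones
-- `4 * 3 ^ (k - 1)`. The factor 3 clears the exponent `k - 1`.
#Before-closed : ∀ k → 3 * #Before (suc k) ≡ (6 + 4 * k) * 3 ^ k
#Before-closed zero    = refl
#Before-closed (suc k) = begin
  3 * (2 * (2 * 3 ^ k) + 3 * #Before (suc k)) ≡⟨ cong (λ x → 3 * (2 * (2 * 3 ^ k) + x)) (#Before-closed k) ⟩
  3 * (2 * (2 * 3 ^ k) + (6 + 4 * k) * 3 ^ k) ≡⟨ lemma k (3 ^ k) ⟩
  (6 + 4 * suc k) * (3 * 3 ^ k)               ∎
  where
  open ≡-Reasoning
  lemma : ∀ k p → 3 * (2 * (2 * p) + (6 + 4 * k) * p) ≡ (6 + 4 * (1 + k)) * (3 * p)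
  lemma = solve-∀

-- The factor 27 clears the exponent `n - 3`, which is negative at `n = 2`; here `n` is `2 + k`, and
-- the factor 2 counts the rows.
#edges : ∀ k → 27 * (2 * (#After (suc k) + #Before (suc k))) ≡ 8 * (2 + k + 1) * 3 ^ (2 + k)
#edges k = begin
  27 * (2 * (2 * 3 ^ k + #Before (suc k)))  ≡⟨ expand (3 ^ k) (#Before (suc k)) ⟩
  108 * 3 ^ k + 18 * (3 * #Before (suc k))  ≡⟨ cong (λ x → 108 * 3 ^ k + 18 * x) (#Before-closed k) ⟩
  108 * 3 ^ k + 18 * ((6 + 4 * k) * 3 ^ k)  ≡⟨ collect k (3 ^ k) ⟩
  8 * (2 + k + 1) * (3 * (3 * 3 ^ k))       ∎
  where
  open ≡-Reasoning
  expand : ∀ p b → 27 * (2 * (2 * p + b)) ≡ 108 * p + 18 * (3 * b)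
  expand = solve-∀
  collect : ∀ k p → 108 * p + 18 * ((6 + 4 * k) * p) ≡ 8 * (2 + k + 1) * (3 * (3 * p))
  collect = solve-∀

theorem3p2 : (n : ℕ) → 2 ≤ n →
    ∃ λ (N : ℕ) → HasCardinality (Edges (OFG n)) N × 27 * N ≡ 8 * (n + 1) * 3 ^ n
theorem3p2 (suc (suc k)) (s≤s (s≤s z≤n)) =
  -- Words have one letter per interior vertex, so their length is `suc k` for `k + 2` columns.
  2 * (#After (suc k) + #Before (suc k)) ,
  bijection (↔⇒⤖ (Fin↔× Fin↔Row (Fin↔⊎ (Fin↔After (suc k)) (Fin↔Before (suc k))))) edgeBijection ,
  #edges k
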